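{- For every message $M$ and formula $\phi$: $\vdash\langle M\rangle\phi\leftrightarrow\neg\neg[M]\phi$.
   Context: Fix a finite set $\mathcal{A}$ of agent names containing a distinguished name $\mathsf{CM}$. Messages: $M ::= a \mid B \mid (M,M)$ ($a\in\mathcal{A}$, $B$ optional data constants, pairs). $\mathcal{P}$ is a denumerable set of propositional variables containing atoms $\mathsf{k}_a(M)$ ("$a$ knows $M$"). Formulas: $\phi ::= P \mid \phi\wedge\phi \mid \phi\vee\phi \mid \neg\phi \mid \phi\to\phi \mid [M]\phi$. Abbreviations: $\mathrm{true}:=\mathsf{k}_{\mathsf{CM}}(\mathsf{CM})$, $\mathrm{false}:=\neg\mathrm{true}$, $\phi\leftrightarrow\psi:=(\phi\to\psi)\wedge(\psi\to\phi)$, $\langle M\rangle\phi:=\neg\neg(\mathsf{k}_{\mathsf{CM}}(M)\wedge\phi)$. LIiP is the smallest set of formulas containing all instances of: the axioms of an adequate Hilbert axiomatization of intuitionistic propositional logic; $\mathsf{k}_a(a)$; $(\mathsf{k}_a(M)\wedge\mathsf{k}_a(M'))\leftrightarrow\mathsf{k}_a((M,M'))$; $[M]\mathsf{k}_{\mathsf{CM}}(M)$; $[M](\phi\to\psi)\to([M]\phi\to[M]\psi)$; $[M]\phi\to(\mathsf{k}_{\mathsf{CM}}(M)\to\phi)$; $[M]\phi\to\langle M\rangle\phi$; $\phi\to[M]\phi$; and closed under modus ponens and the rule: if $\mathsf{k}_{\mathsf{CM}}(M)\to\mathsf{k}_{\mathsf{CM}}(M')$ is in the set then so is $[M']\phi\to[M]\phi$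 for every $\phi$. Write $\vdash\phi$ for $\phi\in\mathrm{LIiP}$. -}

module Defs where

open import Data.Fin using (Fin)
open import Data.Nat using (ℕ)
open import Data.Product using (∃-syntax; _×_)
open import Function.Bundles using (_↔_)
open import Relation.Binary.PropositionalEquality using (_≡_)

data Message (Agent Data : Set) : Set where
  agent : Agent → Message Agent Data
  datum : Data → Message Agent Data
  pair  : Message Agent Data → Message Agent Data → Message Agent Data

record Language : Set₁ where
  field
    Agent        : Set
    agent-finite : ∃[ n ] (Agent ↔ Fin n)
    CM           : Agent
    -- The data constants are optional: Data may be empty.
    Data         : Set
    PVar         : Set
    PVar-denum   : PVar ↔ ℕ
    -- The variables k_a(M) are pairwise distinct, and need not exhaust PVar.
    knows        : Agent → Message Agent Data → PVar
    knows-inj    : ∀ {a b M N} → knows a M ≡ knows b N → a ≡ b × M ≡ N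

module LIiP (L : Language) where
  open Language L

  Msg : Set
  Msg = Message Agent Data

  infix  8 ¬_ [_]_ ⟨_⟩_
  infixr 7 _∧_
  infixr 6 _∨_
  infixr 5 _⇒_
  infix  4 _⇔_
  infix  3 ⊢_

  data Formula : Set where
    var  : PVar → Formula
    _∧_  : Formula → Formula → Formula
    _∨_  : Formula → Formula → Formula
    ¬_   : Formula → Formula
    _⇒_  : Formula → Formula → Formula
    [_]_ : Msg → Formula → Formula

  k : Agent → Msg → Formula
  k a M = var (knows a M)

  true : Formula
  true = k CM (agent CM)

  false : Formula
  false = ¬ true

  _⇔_ : Formula → Formula → Formula
  φ ⇔ ψ = (φ ⇒ ψ) ∧ (ψ ⇒ φ)

  ⟨_⟩_ : Msg → Formula → Formula
  ⟨ M ⟩ φ = ¬ ¬ (k CM M ∧ φ)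

  -- Kleene's axioms for intuitionistic propositional logic with primitive
  -- negation; modus ponens is a rule of ⊢_ below.
  data IPC : Formula → Set where
    ⇒-K     : ∀ φ ψ → IPC (φ ⇒ (ψ ⇒ φ))
    ⇒-S     : ∀ φ ψ χ → IPC ((φ ⇒ (ψ ⇒ χ)) ⇒ ((φ ⇒ ψ) ⇒ (φ ⇒ χ)))
    ∧-elimˡ : ∀ φ ψ → IPC ((φ ∧ ψ) ⇒ φ)
    ∧-elimʳ : ∀ φ ψ → IPC ((φ ∧ ψ) ⇒ ψ)
    ∧-intro : ∀ φ ψ → IPC (φ ⇒ (ψ ⇒ (φ ∧ ψ)))
    ∨-introˡ : ∀ φ ψ → IPC (φ ⇒ (φ ∨ ψ))
    ∨-introʳ : ∀ φ ψ → IPC (ψ ⇒ (φ ∨ ψ))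
    ∨-elim  : ∀ φ ψ χ → IPC ((φ ⇒ χ) ⇒ ((ψ ⇒ χ) ⇒ ((φ ∨ ψ) ⇒ χ)))
    ¬-intro : ∀ φ ψ → IPC ((φ ⇒ ψ) ⇒ ((φ ⇒ ¬ ψ) ⇒ ¬ φ))
    ¬-elim  : ∀ φ ψ → IPC (¬ φ ⇒ (φ ⇒ ψ))

  data ⊢_ : Formula → Set where
    ipc         : ∀ {φ} → IPC φ → ⊢ φ
    own-name    : ∀ a → ⊢ k a (agent a)
    pairing     : ∀ a M N → ⊢ ((k a M ∧ k a N) ⇔ k a (pair M N))
    self-know   : ∀ M → ⊢ [ M ] k CM M
    distrib     : ∀ M φ ψ → ⊢ ([ M ] (φ ⇒ ψ) ⇒ ([ M ] φ ⇒ [ M ] ψ))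
    truthful    : ∀ M φ → ⊢ ([ M ] φ ⇒ (k CM M ⇒ φ))
    box⇒diamond : ∀ M φ → ⊢ ([ M ] φ ⇒ ⟨ M ⟩ φ)
    φ⇒box       : ∀ M φ → ⊢ (φ ⇒ [ M ] φ)
    mp          : ∀ {φ ψ} → ⊢ (φ ⇒ ψ) → ⊢ φ → ⊢ ψ
    antitone    : ∀ {M N} → ⊢ (k CM M ⇒ k CM N) → ∀ φ → ⊢ ([ N ] φ ⇒ [ M ] φ)

{-# OPTIONS --safe #-}
-- Both directions are double-negation monotonicity: of k_CM(M) ∧ φ ⇒ φ ⇒ [M]φ
-- from left to right, and of [M]φ ⇒ ⟨M⟩φ from right to left, where the
-- resulting ¬¬⟨M⟩φ collapses because ⟨M⟩φ is itself a negation.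
module Submission where

open import Defs

module _ (L : Language) where
  open LIiP L

  ⇒-weaken : ∀ {φ ψ} → ⊢ φ → ⊢ (ψ ⇒ φ)
  ⇒-weaken = mp (ipc (⇒-K _ _))

  -- Modus ponens under a hypothesis `φ`; it does the work of a deduction theorem.
  ⇒-apply : ∀ {φ ψ χ} → ⊢ (φ ⇒ (ψ ⇒ χ)) → ⊢ (φ ⇒ ψ) → ⊢ (φ ⇒ χ)
  ⇒-apply f g = mp (mp (ipc (⇒-S _ _ _)) f) g

  ⇒-refl : ∀ φ → ⊢ (φ ⇒ φ)
  ⇒-refl φ = ⇒-apply (ipc (⇒-K φ (φ ⇒ φ))) (ipc (⇒-K φ φ))

  ⇒-trans : ∀ {φ ψ χ} → ⊢ (φ ⇒ ψ) → ⊢ (ψ ⇒ χ) → ⊢ (φ ⇒ χ)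
  ⇒-trans f g = ⇒-apply (⇒-weaken g) f

  contraposition : ∀ {φ ψ} → ⊢ (φ ⇒ ψ) → ⊢ (¬ ψ ⇒ ¬ φ)
  -- `⇒-K` turns `¬ ψ` into `φ ⇒ ¬ ψ`, which together with `f` refutes `φ`.
  contraposition f = ⇒-trans (ipc (⇒-K _ _)) (mp (ipc (¬-intro _ _)) f)

  ¬¬-map : ∀ {φ ψ} → ⊢ (φ ⇒ ψ) → ⊢ (¬ ¬ φ ⇒ ¬ ¬ ψ)
  ¬¬-map f = contraposition (contraposition f)

  ¬¬-intro : ∀ φ → ⊢ (φ ⇒ ¬ ¬ φ)
  ¬¬-intro φ =
    -- Given `φ`, the assumption `¬ φ` implies both `φ` and itself, so `¬-intro` refutes it.
    ⇒-apply (⇒-trans (ipc (⇒-K φ (¬ φ))) (ipc (¬-intro (¬ φ) φ)))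
            (⇒-weaken (⇒-refl (¬ φ)))

  ¬¬¬-elim : ∀ φ → ⊢ (¬ ¬ ¬ φ ⇒ ¬ φ)
  ¬¬¬-elim φ = contraposition (¬¬-intro φ)

  ⇔-intro : ∀ {φ ψ} → ⊢ (φ ⇒ ψ) → ⊢ (ψ ⇒ φ) → ⊢ (φ ⇔ ψ)
  ⇔-intro f g = mp (mp (ipc (∧-intro _ _)) f) g

theorem2p58 : (L : Language) → let open LIiP L in
    (M : Msg) (φ : Formula) → ⊢ (⟨ M ⟩ φ ⇔ ¬ ¬ ([ M ] φ))
theorem2p58 L M φ =
  ⇔-intro L
    (¬¬-map L (⇒-trans L (ipc (∧-elimʳ _ _)) (φ⇒box M φ)))
    -- The `_` is `¬ (k CM M ∧ φ)`: four negations drop to two.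
    (⇒-trans L (¬¬-map L (box⇒diamond M φ)) (¬¬¬-elim L _))
  where open LIiP L
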